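{- Suppose $\mathcal D=(\mathcal P,\mathcal B,\mathcal I)$ is a non-trivial $G$-pairwise transitive $2$-design, where $G\le\mathrm{Aut}(\mathcal D)$, $G^{\mathcal P}$ is of almost simple type, and $G^{\mathcal B}$ is imprimitive of rank $3$, with (nontrivial) system of imprimitivity $\mathcal S$ on $\mathcal B$. Then the two actions $G^{\mathcal P}$ and $G^{\mathcal S}$ are not the point and hyperplane actions of a projective linear group; that is, there are no $a\ge3$ and prime power $q$ such that $G$ has socle $\mathrm{PSL}(a,q)$ with $G$ acting on $\mathcal P$ as on the points, and on $\mathcal S$ as on the hyperplanes, of $\mathrm{PG}(a-1,q)$.
   Context: A design $\mathcal D=(\mathcal P,\mathcal B,\mathcal I)$ consists of finite sets $\mathcal P$ (points), $\mathcal B$ (blocks) and an incidence relation $\mathcal I\subseteq\mathcal P\times\mathcal B$. It is a $2$-$(v,k,\lambda)$ design (or $2$-design) if $|\mathcal P|=v$, each block is incident with exactly $k$ points, and each pair of distinct points is incident with exactly $\lambda$ common blocks. It is non-trivial if $2<k<v$. An automorphism is a permutation of $\mathcal P\cup\mathcal B$ leaving $\mathcal P$ and $\mathcal B$ invariant setwise and preserving incidence; $\mathrm{Aut}(\mathcal D)$ is the group of all automorphisms. Two blocks are intersecting if some point is incident with both. For $G\le\mathrm{Aut}(\mathcal D)$, the $2$-design $\mathcal D$ is $G$-pairwise transitive if $G$ is transitive on each of the following five (possibly empty) sets of ordered pairs: pairs of distinct points, incident point-block pairs, non-incident point-block pairs, pairs of distinct intersecting blocks, pairs of non-intersecting blocks.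 $G^{X}$ denotes the permutation group induced by $G$ on $X$. A transitive permutation group has rank $n$ if a point stabiliser has exactly $n$ orbits. A permutation group is of almost simple type if it is an almost simple group. A system of imprimitivity is a $G$-invariant partition; it is nontrivial if its parts are neither singletons nor the whole set (for an imprimitive rank $3$ group it is unique). -}

module Defs where

open import Algebra.Apartness.Bundles using (HeytingCommutativeRing; HeytingField)
open import Algebra.Bundles using (CommutativeRing; Group)
open import Algebra.Construct.DirectProduct using (group)
open import Algebra.Morphism.Construct.Composition using (isRingHomomorphism)
open import Algebra.Morphism.Structures using (IsMagmaHomomorphism; IsGroupHomomorphism; IsGroupMonomorphism; IsRingHomomorphism)
open import Data.Fin.Base using (Fin; zero; suc; toℕ; punchIn)
open import Data.List.Base using (length; filter; allFin)
open import Data.Nat.Base as ℕ using (ℕ; zero; suc; _∸_)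
open import Data.Nat.Primality using (Prime)
open import Data.Product.Base using (Σ; Σ-syntax; ∃-syntax; _×_; _,_; proj₁; proj₂)
open import Data.Vec.Functional using (Vector)
open import Data.Vec.Functional.Relation.Binary.Equality.Setoid using (≋-setoid)
open import Function.Base using (_on_)
open import Function.Bundles using (Inverse; _⇔_; mk⇔)
import Function.Construct.Composition as Comp
import Function.Construct.Identity as Iden
import Function.Construct.Symmetry as Symm
open import Level using (Level; 0ℓ; _⊔_) renaming (suc to lsuc)
open import Relation.Binary.Bundles using (Setoid)
open import Relation.Binary.Core using (Rel; REL)
import Relation.Binary.Construct.On as On
open import Relation.Binary.Definitions using (Decidable)
import Relation.Binary.PropositionalEquality as ≡
open ≡ using (_≡_; _≢_)
import Relation.Binary.Reasoning.Setoid as SetoidReasoning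
open import Relation.Binary.Structures using (IsDecEquivalence)
open import Relation.Nullary.Decidable using (_×-dec_)
open import Relation.Nullary.Negation using (¬_)
open import Relation.Unary using (Pred; _∈_; _⊆_; _≐_)

private
  variable
    c ℓ p p′ : Level

record Subgroup (G : Group c ℓ) (p : Level) : Set (c ⊔ ℓ ⊔ lsuc p) where
  open Group G
  field
    Mem       : Pred Carrier p
    resp      : ∀ {x y} → x ≈ y → x ∈ Mem → y ∈ Mem
    ε-mem     : ε ∈ Mem
    ∙-closed  : ∀ {x y} → x ∈ Mem → y ∈ Mem → (x ∙ y) ∈ Mem
    ⁻¹-closed : ∀ {x} → x ∈ Mem → (x ⁻¹) ∈ Mem

open Subgroup using (Mem)

asGroup : {G : Group c ℓ} → Subgroup G p → Group (c ⊔ p) ℓ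
asGroup {G = G} H = record
  { Carrier = Σ Carrier H.Mem
  ; _≈_     = _≈_ on proj₁
  ; _∙_     = λ (x , x∈) (y , y∈) → x ∙ y , H.∙-closed x∈ y∈
  ; ε       = ε , H.ε-mem
  ; _⁻¹     = λ (x , x∈) → x ⁻¹ , H.⁻¹-closed x∈
  ; isGroup = record
    { isMonoid = record
      { isSemigroup = record
        { isMagma = record
          { isEquivalence = On.isEquivalence proj₁ isEquivalence
          ; ∙-cong        = ∙-cong
          }
        ; assoc = λ x y z → assoc (proj₁ x) (proj₁ y) (proj₁ z)
        }
      ; identity = (λ x → identityˡ (proj₁ x)) , (λ x → identityʳ (proj₁ x))
      }
    ; inverse = (λ x → inverseˡ (proj₁ x)) , (λ x → inverseʳ (proj₁ x))
    ; ⁻¹-cong = ⁻¹-cong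
    }
  }
  where
  open Group G
  module H = Subgroup H

image : {G : Group c ℓ} {H : Group p p′} {f : Group.Carrier G → Group.Carrier H} →
        IsGroupHomomorphism (Group.rawGroup G) (Group.rawGroup H) f →
        Subgroup H (c ⊔ p′)
image {G = G} {H} {f} f-homo = record
  { Mem       = λ y → ∃[ x ] f x ≈ y
  ; resp      = λ y≈z (x , e) → x , trans e y≈z
  ; ε-mem     = G.ε , ε-homo
  ; ∙-closed  = λ (x , e) (y , e′) → x G.∙ y , trans (homo x y) (∙-cong e e′)
  ; ⁻¹-closed = λ (x , e) → x G.⁻¹ , trans (⁻¹-homo x) (⁻¹-cong e)
  }
  where
  module G = Group G
  open Group H
  open IsGroupHomomorphism f-homo

IsNormal : {G : Group c ℓ} → Subgroup G p → Set (c ⊔ p)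
IsNormal {G = G} N = ∀ g {n} → n ∈ N .Mem → ((g ∙ n) ∙ g ⁻¹) ∈ N .Mem
  where open Group G

-- G / N has the elements of G, with x and y identified when x y⁻¹ ∈ N.
quotient : (G : Group c ℓ) (N : Subgroup G p) → IsNormal N → Group c p
quotient G N normal = record
  { Carrier = Carrier
  ; _≈_     = λ x y → (x // y) ∈ N.Mem
  ; _∙_     = _∙_
  ; ε       = ε
  ; _⁻¹     = _⁻¹
  ; isGroup = record
    { isMonoid = record
      { isSemigroup = record
        { isMagma = record
          { isEquivalence = record
            { refl  = embed refl
            ; sym   = λ {x} {y} e → N.resp (⁻¹-// x y) (N.⁻¹-closed e)
            ; trans = λ {x} {y} {z} e e′ → N.resp (//-// x y z) (N.∙-closed e e′)
            }
          ; ∙-cong = λ {x} {y} {u} {w} e e′ →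
              N.resp (//-∙ x y u w) (N.∙-closed (normal x e′) e)
          }
        ; assoc = λ x y z → embed (assoc x y z)
        }
      ; identity = (λ x → embed (identityˡ x)) , (λ x → embed (identityʳ x))
      }
    ; inverse = (λ x → embed (inverseˡ x)) , (λ x → embed (inverseʳ x))
    ; ⁻¹-cong = λ {x} {y} e →
        N.resp (conj-// x y) (normal (x ⁻¹) (N.resp (⁻¹-// x y) (N.⁻¹-closed e)))
    }
  }
  where
  open Group G
  module N = Subgroup N
  open import Algebra.Properties.Group G using (⁻¹-involutive; ⁻¹-anti-homo-∙)
  open SetoidReasoning setoid

  embed : ∀ {x y} → x ≈ y → (x // y) ∈ N.Mem
  embed {x} {y} e = N.resp (sym (trans (∙-congʳ e) (inverseʳ y))) N.ε-mem

  ⁻¹-// : ∀ x y → (x // y) ⁻¹ ≈ y // x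
  ⁻¹-// x y = trans (⁻¹-anti-homo-∙ x (y ⁻¹)) (∙-congʳ (⁻¹-involutive y))

  //-// : ∀ x y z → (x // y) ∙ (y // z) ≈ x // z
  //-// x y z = begin
    (x ∙ y ⁻¹) ∙ (y ∙ z ⁻¹)  ≈⟨ assoc x (y ⁻¹) (y ∙ z ⁻¹) ⟩
    x ∙ (y ⁻¹ ∙ (y ∙ z ⁻¹))  ≈⟨ ∙-congˡ (assoc (y ⁻¹) y (z ⁻¹)) ⟨
    x ∙ ((y ⁻¹ ∙ y) ∙ z ⁻¹)  ≈⟨ ∙-congˡ (∙-congʳ (inverseˡ y)) ⟩
    x ∙ (ε ∙ z ⁻¹)           ≈⟨ ∙-congˡ (identityˡ (z ⁻¹)) ⟩
    x ∙ z ⁻¹                 ∎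

  //-∙ : ∀ x y u w → ((x ∙ (u // w)) ∙ x ⁻¹) ∙ (x // y) ≈ (x ∙ u) // (y ∙ w)
  //-∙ x y u w = begin
    ((x ∙ (u // w)) ∙ x ⁻¹) ∙ (x // y)  ≈⟨ //-// (x ∙ (u // w)) x y ⟩
    (x ∙ (u ∙ w ⁻¹)) ∙ y ⁻¹             ≈⟨ ∙-congʳ (assoc x u (w ⁻¹)) ⟨
    ((x ∙ u) ∙ w ⁻¹) ∙ y ⁻¹             ≈⟨ assoc (x ∙ u) (w ⁻¹) (y ⁻¹) ⟩
    (x ∙ u) ∙ (w ⁻¹ ∙ y ⁻¹)             ≈⟨ ∙-congˡ (⁻¹-anti-homo-∙ y w) ⟨
    (x ∙ u) ∙ (y ∙ w) ⁻¹                ∎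

  conj-// : ∀ x y → (x ⁻¹ ∙ (y // x)) ∙ (x ⁻¹) ⁻¹ ≈ (x ⁻¹) // (y ⁻¹)
  conj-// x y = begin
    (x ⁻¹ ∙ (y ∙ x ⁻¹)) ∙ (x ⁻¹) ⁻¹  ≈⟨ ∙-congʳ (assoc (x ⁻¹) y (x ⁻¹)) ⟨
    ((x ⁻¹ ∙ y) ∙ x ⁻¹) ∙ (x ⁻¹) ⁻¹  ≈⟨ assoc (x ⁻¹ ∙ y) (x ⁻¹) ((x ⁻¹) ⁻¹) ⟩
    (x ⁻¹ ∙ y) ∙ (x ⁻¹ ∙ (x ⁻¹) ⁻¹)  ≈⟨ ∙-congˡ (inverseʳ (x ⁻¹)) ⟩
    (x ⁻¹ ∙ y) ∙ ε                   ≈⟨ identityʳ (x ⁻¹ ∙ y) ⟩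
    x ⁻¹ ∙ y                         ≈⟨ ∙-congˡ (⁻¹-involutive y) ⟨
    x ⁻¹ ∙ (y ⁻¹) ⁻¹                 ∎

-- Stated positively, so that "every non-trivial normal subgroup is ..." asks
-- for no decision between N = 1 and N ≠ 1.
IsNontrivial : {G : Group c ℓ} → Subgroup G p → Set (c ⊔ ℓ ⊔ p)
IsNontrivial {G = G} N = ∃[ x ] x ∈ N .Mem × ¬ (x ≈ ε)
  where open Group G

record IsNonabelianSimple (T : Group 0ℓ 0ℓ) : Set₁ where
  open Group T
  field
    nonabelian : ¬ (∀ x y → x ∙ y ≈ y ∙ x)
    simple     : (N : Subgroup T 0ℓ) → IsNormal N → IsNontrivial N → ∀ x → x ∈ N .Mem

record IsMinimalNormal {G : Group 0ℓ 0ℓ} (N : Subgroup G 0ℓ) : Set₁ where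
  field
    normal     : IsNormal N
    nontrivial : IsNontrivial N
    minimal    : (M : Subgroup G 0ℓ) → IsNormal M → IsNontrivial M →
                 M .Mem ⊆ N .Mem → N .Mem ⊆ M .Mem

-- The subgroup generated by all minimal normal subgroups.
module _ (G : Group 0ℓ 0ℓ) where
  open Group G

  data Socle : Pred Carrier (lsuc 0ℓ) where
    gen  : (N : Subgroup G 0ℓ) → IsMinimalNormal N → ∀ {x} → x ∈ N .Mem → Socle x
    eq   : ∀ {x y} → x ≈ y → Socle x → Socle y
    unit : Socle ε
    mult : ∀ {x y} → Socle x → Socle y → Socle (x ∙ y)
    inv  : ∀ {x} → Socle x → Socle (x ⁻¹)

-- Composition in Sym X is that of functions: (f ∙ g) x = f (g x).
Sym : Setoid c ℓ → Group (c ⊔ ℓ) (c ⊔ ℓ)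
Sym X = record
  { Carrier = Inverse X X
  ; _≈_     = λ f g → ∀ x → to f x ≈ to g x
  ; _∙_     = λ f g → Comp.inverse g f
  ; ε       = Iden.inverse X
  ; _⁻¹     = Symm.inverse
  ; isGroup = record
    { isMonoid = record
      { isSemigroup = record
        { isMagma = record
          { isEquivalence = record
            { refl  = λ _ → refl
            ; sym   = λ e x → sym (e x)
            ; trans = λ e e′ x → trans (e x) (e′ x)
            }
          ; ∙-cong = λ {f} {g} {h} {k} e e′ x → trans (to-cong f (e′ x)) (e (to k x))
          }
        ; assoc = λ _ _ _ _ → refl
        }
      ; identity = (λ _ _ → refl) , (λ _ _ → refl)
      }
    ; inverse = (λ f x → inverseʳ f refl) , (λ f x → inverseˡ f refl)
    ; ⁻¹-cong = λ {f} {g} e x →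
        inverseʳ f (trans (sym (inverseˡ g refl)) (sym (e (from g x))))
    }
  }
  where
  open Setoid X
  open Inverse

GroupAut : (T : Group c ℓ) → Subgroup (Sym (Group.setoid T)) (c ⊔ ℓ)
GroupAut T = record
  { Mem       = λ f → IsMagmaHomomorphism rawMagma rawMagma (to f)
  ; resp      = λ {f} {g} e h → let open IsMagmaHomomorphism h in mk g λ x y →
      trans (sym (e (x ∙ y))) (trans (homo x y) (∙-cong (e x) (e y)))
  ; ε-mem     = mk (Iden.inverse setoid) λ _ _ → refl
  ; ∙-closed  = λ {f} {g} h k → mk (Comp.inverse g f) λ x y →
      trans (to-cong f (IsMagmaHomomorphism.homo k x y))
            (IsMagmaHomomorphism.homo h (to g x) (to g y))
  ; ⁻¹-closed = λ {f} h → mk (Symm.inverse f) λ x y →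
      inverseʳ f (trans (sym (∙-cong (inverseˡ f refl) (inverseˡ f refl)))
                        (sym (IsMagmaHomomorphism.homo h (from f x) (from f y))))
  }
  where
  open Group T hiding (inverseˡ; inverseʳ)
  open Inverse
  mk : (f : Inverse setoid setoid) → (∀ x y → to f (x ∙ y) ≈ to f x ∙ to f y) →
       IsMagmaHomomorphism rawMagma rawMagma (to f)
  mk f homo = record { isRelHomomorphism = record { cong = to-cong f } ; homo = homo }

-- Inn T ≤ H ≤ Aut T for a non-abelian simple group T, up to isomorphism.
record IsAlmostSimple (H : Group 0ℓ 0ℓ) : Set₁ where
  private module H = Group H
  field
    T       : Group 0ℓ 0ℓ
    isNAS   : IsNonabelianSimple T
  open Group T
  field
    ι       : H.Carrier → Group.Carrier (asGroup (GroupAut T))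
    ι-mono  : IsGroupMonomorphism H.rawGroup (Group.rawGroup (asGroup (GroupAut T))) ι
    inner   : ∀ t → ∃[ h ] ∀ x → Inverse.to (proj₁ (ι h)) x ≈ (t ∙ x) ∙ t ⁻¹

module _ {X : Setoid 0ℓ 0ℓ} (H : Subgroup (Sym X) 0ℓ) where
  open Setoid X
  open Inverse using (to; to-cong; inverseʳ)

  IsTransitive : Set
  IsTransitive = ∀ x y → ∃[ h ] h ∈ H .Mem × to h x ≈ y

  stabiliserOrbits : Carrier → Setoid 0ℓ 0ℓ
  stabiliserOrbits α = record
    { Carrier       = Carrier
    ; _≈_           = λ x y → ∃[ h ] h ∈ H .Mem × to h α ≈ α × to h x ≈ y
    ; isEquivalence = record
      { refl  = Iden.inverse X , H.ε-mem , refl , refl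
      ; sym   = λ (h , h∈ , fix , e) →
          Symm.inverse h , H.⁻¹-closed h∈ , inverseʳ h (sym fix) , inverseʳ h (sym e)
      ; trans = λ (h , h∈ , fix , e) (k , k∈ , fix′ , e′) →
          Comp.inverse h k , H.∙-closed k∈ h∈ ,
          trans (to-cong k fix) fix′ , trans (to-cong k e) e′
      }
    }
    where module H = Subgroup H

  HasRank : ℕ → Set
  HasRank n = IsTransitive × ∃[ α ] Inverse (≡.setoid (Fin n)) (stabiliserOrbits α)

  -- The partition is given by the equivalence relation of lying in the same part.
  record IsNontrivialImprimitivitySystem (_∼_ : Rel Carrier 0ℓ) : Set where
    field
      isDecEquivalence : IsDecEquivalence _∼_
      respects         : ∀ {x y} → x ≈ y → x ∼ y
      invariant        : ∀ {h} → h ∈ H .Mem → ∀ {x y} → x ∼ y → to h x ∼ to h y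
      not-singleton    : ∀ x → ∃[ y ] ¬ (x ≈ y) × x ∼ y
      not-whole        : ∀ x → ∃[ y ] ¬ (x ∼ y)

    parts : Setoid 0ℓ 0ℓ
    parts = record { isEquivalence = IsDecEquivalence.isEquivalence isDecEquivalence }

-- Blocks are abstract: distinct blocks may be incident with the same points.
record Design (v b : ℕ) : Set₁ where
  field
    _I_  : REL (Fin v) (Fin b) 0ℓ
    _I?_ : Decidable _I_

module _ {v b : ℕ} (𝒟 : Design v b) where
  open Design 𝒟

  record Is2Design (k lam : ℕ) : Set where
    field
      block-size : ∀ B → length (filter (_I? B) (allFin v)) ≡ k
      pair-count : ∀ p q → p ≢ q →
                   length (filter (λ B → (p I? B) ×-dec (q I? B)) (allFin b)) ≡ lam

  -- A permutation of the disjoint union of points and blocks fixing both sets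
  -- is a pair of permutations.
  Aut : Subgroup (group (Sym (≡.setoid (Fin v))) (Sym (≡.setoid (Fin b)))) 0ℓ
  Aut = record
    { Mem       = λ (π , σ) → ∀ p B → p I B ⇔ to π p I to σ B
    ; resp      = λ (e , e′) h p B → ≡.subst₂ (λ q C → p I B ⇔ q I C) (e p) (e′ B) (h p B)
    ; ε-mem     = λ _ _ → mk⇔ (λ i → i) (λ i → i)
    ; ∙-closed  = λ {x} {y} h k p B →
        Comp.equivalence (k p B) (h (to (proj₁ y) p) (to (proj₂ y) B))
    ; ⁻¹-closed = λ {(π , σ)} h p B → Symm.equivalence
        (≡.subst₂ (λ q C → from π p I from σ B ⇔ q I C)
          (inverseˡ π ≡.refl) (inverseˡ σ ≡.refl) (h (from π p) (from σ B)))
    }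
    where open Inverse

  Intersecting : Rel (Fin b) 0ℓ
  Intersecting B C = ∃[ p ] p I B × p I C

  module _ (G : Subgroup (asGroup Aut) 0ℓ) where
    private module G = Group (asGroup G)

    pointPerm : G.Carrier → Group.Carrier (Sym (≡.setoid (Fin v)))
    pointPerm (((π , _) , _) , _) = π

    blockPerm : G.Carrier → Group.Carrier (Sym (≡.setoid (Fin b)))
    blockPerm (((_ , σ) , _) , _) = σ

    onPoint : G.Carrier → Fin v → Fin v
    onPoint g = Inverse.to (pointPerm g)

    onBlock : G.Carrier → Fin b → Fin b
    onBlock g = Inverse.to (blockPerm g)

    inducedOnPoints : Subgroup (Sym (≡.setoid (Fin v))) 0ℓ
    inducedOnPoints = image {G = asGroup G} {f = pointPerm} record
      { isMonoidHomomorphism = record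
        { isMagmaHomomorphism = record
          { isRelHomomorphism = record { cong = proj₁ }
          ; homo              = λ _ _ _ → ≡.refl
          }
        ; ε-homo = λ _ → ≡.refl
        }
      ; ⁻¹-homo = λ _ _ → ≡.refl
      }

    inducedOnBlocks : Subgroup (Sym (≡.setoid (Fin b))) 0ℓ
    inducedOnBlocks = image {G = asGroup G} {f = blockPerm} record
      { isMonoidHomomorphism = record
        { isMagmaHomomorphism = record
          { isRelHomomorphism = record { cong = proj₂ }
          ; homo              = λ _ _ _ → ≡.refl
          }
        ; ε-homo = λ _ → ≡.refl
        }
      ; ⁻¹-homo = λ _ _ → ≡.refl
      }

    record IsPairwiseTransitive : Set where
      field
        points : ∀ {p q p′ q′} → p ≢ q → p′ ≢ q′ →
                 ∃[ g ] onPoint g p ≡ p′ × onPoint g q ≡ q′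
        flags : ∀ {p B p′ B′} → p I B → p′ I B′ →
                ∃[ g ] onPoint g p ≡ p′ × onBlock g B ≡ B′
        antiflags : ∀ {p B p′ B′} → ¬ (p I B) → ¬ (p′ I B′) →
                    ∃[ g ] onPoint g p ≡ p′ × onBlock g B ≡ B′
        intersecting : ∀ {B C B′ C′} → B ≢ C → Intersecting B C →
                       B′ ≢ C′ → Intersecting B′ C′ →
                       ∃[ g ] onBlock g B ≡ B′ × onBlock g C ≡ C′
        nonintersecting : ∀ {B C B′ C′} → ¬ Intersecting B C → ¬ Intersecting B′ C′ →
                          ∃[ g ] onBlock g B ≡ B′ × onBlock g C ≡ C′

IsPrimePower : ℕ → Set
IsPrimePower q = ∃[ r ] ∃[ e ] Prime r × q ≡ r ℕ.^ suc e

module Projective (F : HeytingField 0ℓ 0ℓ 0ℓ) where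
  open HeytingField F using (_#_; #⇒invertible; invertible⇒#; heytingCommutativeRing)
  open CommutativeRing (HeytingCommutativeRing.commutativeRing heytingCommutativeRing) hiding (zero)
  open import Algebra.Properties.Semiring.Exp semiring using (_^_)
  open import Algebra.Properties.Semiring.Sum semiring using (sum)
  open import Algebra.Properties.Ring ring using (-0#≈0#)
  open Inverse

  -- A field of order q is GF(q), by uniqueness of finite fields.
  HasOrder : ℕ → Set
  HasOrder q = Inverse (≡.setoid (Fin q)) setoid

  V : ℕ → Setoid 0ℓ 0ℓ
  V = ≋-setoid setoid

  infix 4 _≋_
  _≋_ : ∀ {n} → Rel (Vector Carrier n) 0ℓ
  _≋_ {n} = Setoid._≈_ (V n)

  private
    module V {n} = Setoid (V n)

  infixl 6 _⊕_
  infixr 7 _•_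

  𝟎 : ∀ {n} → Vector Carrier n
  𝟎 _ = 0#

  _⊕_ : ∀ {n} → Vector Carrier n → Vector Carrier n → Vector Carrier n
  (u ⊕ w) i = u i + w i

  _•_ : ∀ {n} → Carrier → Vector Carrier n → Vector Carrier n
  (s • w) i = s * w i

  combination : ∀ {n d} → Vector Carrier d → Vector (Vector Carrier n) d → Vector Carrier n
  combination s ws i = sum (λ j → s j * ws j i)

  private
    ⊕-cong : ∀ {n} {u u′ w w′ : Vector Carrier n} → u ≋ u′ → w ≋ w′ → u ⊕ w ≋ u′ ⊕ w′
    ⊕-cong e e′ i = +-cong (e i) (e′ i)

    •-cong : ∀ {n} {s s′} {w w′ : Vector Carrier n} → s ≈ s′ → w ≋ w′ → s • w ≋ s′ • w′
    •-cong e e′ i = *-cong e (e′ i)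

    #0⇒unit : ∀ {s} → s # 0# → ∃[ t ] t * s ≈ 1#
    #0⇒unit s# = let t , e , _ = #⇒invertible s# in
      t , trans (*-congˡ (sym (trans (+-congˡ -0#≈0#) (+-identityʳ _)))) e

    unit⇒#0 : ∀ {s t} → t * s ≈ 1# → s # 0#
    unit⇒#0 {s} {t} e = invertible⇒# (t , l , trans (*-comm _ _) l)
      where
      l : t * (s - 0#) ≈ 1#
      l = trans (*-congˡ (trans (+-congˡ -0#≈0#) (+-identityʳ s))) e

  Matrix : ℕ → Set
  Matrix n = Fin n → Fin n → Carrier

  -- Laplace expansion along the first row.
  det : ∀ {n} → Matrix n → Carrier
  det {zero}  A = 1#
  det {suc n} A =
    sum (λ j → ((- 1#) ^ toℕ j * A zero j) * det (λ i k → A (suc i) (punchIn j k)))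

  _*ᵥ_ : ∀ {n} → Matrix n → Vector Carrier n → Vector Carrier n
  (A *ᵥ w) i = sum (λ j → A i j * w j)

  FieldAut : Subgroup (Sym setoid) 0ℓ
  FieldAut = record
    { Mem       = λ f → IsRingHomomorphism rawRing rawRing (to f)
    ; resp      = λ {f} {g} e h → let open IsRingHomomorphism h in
        mk g (λ x y → trans (sym (e _)) (trans (+-homo x y) (+-cong (e x) (e y))))
             (λ x y → trans (sym (e _)) (trans (*-homo x y) (*-cong (e x) (e y))))
             (λ x → trans (sym (e _)) (trans (-‿homo x) (-‿cong (e x))))
             (trans (sym (e _)) 0#-homo)
             (trans (sym (e _)) 1#-homo)
    ; ε-mem     = mk (Iden.inverse setoid) (λ _ _ → refl) (λ _ _ → refl) (λ _ → refl) refl refl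
    ; ∙-closed  = λ h k → isRingHomomorphism trans k h
    ; ⁻¹-closed = λ {f} h → let open IsRingHomomorphism h in
        mk (Symm.inverse f)
           (λ x y → inverseʳ f (sym (trans (+-homo _ _) (+-cong (inverseˡ f refl) (inverseˡ f refl)))))
           (λ x y → inverseʳ f (sym (trans (*-homo _ _) (*-cong (inverseˡ f refl) (inverseˡ f refl)))))
           (λ x → inverseʳ f (sym (trans (-‿homo _) (-‿cong (inverseˡ f refl)))))
           (inverseʳ f (sym 0#-homo))
           (inverseʳ f (sym 1#-homo))
    }
    where
    mk : (f : Inverse setoid setoid) →
         (∀ x y → to f (x + y) ≈ to f x + to f y) →
         (∀ x y → to f (x * y) ≈ to f x * to f y) →
         (∀ x → to f (- x) ≈ - to f x) →
         to f 0# ≈ 0# → to f 1# ≈ 1# → IsRingHomomorphism rawRing rawRing (to f)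
    mk f p m n 0-homo 1-homo = record
      { isSemiringHomomorphism = record
        { isNearSemiringHomomorphism = record
          { +-isMonoidHomomorphism = record
            { isMagmaHomomorphism = record
              { isRelHomomorphism = record { cong = to-cong f }
              ; homo              = p
              }
            ; ε-homo = 0-homo
            }
          ; *-homo = m
          }
        ; 1#-homo = 1-homo
        }
      ; -‿homo = n
      }

  record IsSemilinear {n} (T : Inverse (V n) (V n)) : Set where
    field
      additive     : ∀ u w → to T (u ⊕ w) ≋ to T u ⊕ to T w
      companion    : Inverse setoid setoid
      companion-∈  : companion ∈ FieldAut .Mem
      semilinear   : ∀ s w → to T (s • w) ≋ to companion s • to T w

  ΓL : ∀ n → Subgroup (Sym (V n)) 0ℓ
  ΓL n = record
    { Mem       = IsSemilinear
    ; resp      = λ e t → let open IsSemilinear t in record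
      { additive    = λ u w →
          V.trans (V.sym (e (u ⊕ w))) (V.trans (additive u w) (⊕-cong (e u) (e w)))
      ; companion   = companion
      ; companion-∈ = companion-∈
      ; semilinear  = λ s w →
          V.trans (V.sym (e (s • w))) (V.trans (semilinear s w) (•-cong refl (e w)))
      }
    ; ε-mem     = record
      { additive    = λ _ _ → V.refl
      ; companion   = Iden.inverse setoid
      ; companion-∈ = Aut.ε-mem
      ; semilinear  = λ _ _ → V.refl
      }
    ; ∙-closed  = λ {f} {g} t t′ → let open IsSemilinear in record
      { additive    = λ u w →
          V.trans (to-cong f (additive t′ u w)) (additive t (to g u) (to g w))
      ; companion   = Comp.inverse (companion t′) (companion t)
      ; companion-∈ = Aut.∙-closed {companion t} {companion t′} (companion-∈ t) (companion-∈ t′)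
      ; semilinear  = λ s w →
          V.trans (to-cong f (semilinear t′ s w)) (semilinear t (to (companion t′) s) (to g w))
      }
    ; ⁻¹-closed = λ {f} t → let open IsSemilinear t in record
      { additive    = λ u w → inverseʳ f (V.sym
          (V.trans (additive _ _) (⊕-cong (inverseˡ f V.refl) (inverseˡ f V.refl))))
      ; companion   = Symm.inverse companion
      ; companion-∈ = Aut.⁻¹-closed {companion} companion-∈
      ; semilinear  = λ s w → inverseʳ f (V.sym
          (V.trans (semilinear _ _) (•-cong (inverseˡ companion refl) (inverseˡ f V.refl))))
      }
    }
    where module Aut = Subgroup FieldAut

  Scalars : ∀ n → Subgroup (asGroup (ΓL n)) 0ℓ
  Scalars n = record
    { Mem       = λ (T , _) → ∃[ s ] s # 0# × (∀ w → to T w ≋ s • w)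
    ; resp      = λ e (s , s# , h) → s , s# , λ w → V.trans (V.sym (e w)) (h w)
    ; ε-mem     = 1# , unit⇒#0 (*-identityˡ 1#) , λ w i → sym (*-identityˡ (w i))
    ; ∙-closed  = λ {(f , _)} (s , s# , h) (t , t# , k) →
        let s⁻¹ , e = #0⇒unit s#
            t⁻¹ , e′ = #0⇒unit t#
        in s * t
         , unit⇒#0 {t = t⁻¹ * s⁻¹} (trans (*-assoc t⁻¹ s⁻¹ (s * t))
             (trans (*-congˡ (trans (sym (*-assoc s⁻¹ s t)) (trans (*-congʳ e) (*-identityˡ t)))) e′))
         , λ w → V.trans (to-cong f (k w))
             (V.trans (h (t • w)) (λ i → sym (*-assoc s t (w i))))
    ; ⁻¹-closed = λ {(f , _)} (s , s# , h) →
        let s⁻¹ , e = #0⇒unit s#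
        in s⁻¹
         , unit⇒#0 {t = s} (trans (*-comm s s⁻¹) e)
         , λ w → inverseʳ f (V.sym (V.trans (h (s⁻¹ • w)) λ i →
             trans (sym (*-assoc s s⁻¹ (w i)))
               (trans (*-congʳ (trans (*-comm s s⁻¹) e)) (*-identityˡ (w i)))))
    }

  Scalars-normal : ∀ n → IsNormal (Scalars n)
  Scalars-normal n (g , g-sl) (s , s# , h) =
    let open IsSemilinear g-sl
        module σ = IsRingHomomorphism companion-∈
        s⁻¹ , e = #0⇒unit s#
    in to companion s
     , unit⇒#0 {t = to companion s⁻¹}
         (trans (sym (σ.*-homo s⁻¹ s)) (trans (σ.⟦⟧-cong e) σ.1#-homo))
     , λ w → V.trans (to-cong g (h (from g w)))
         (V.trans (semilinear s (from g w)) (•-cong refl (inverseˡ g V.refl)))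

  PΓL : ℕ → Group 0ℓ 0ℓ
  PΓL n = quotient (asGroup (ΓL n)) (Scalars n) (Scalars-normal n)

  IsSpecialLinear : ∀ {n} → Inverse (V n) (V n) → Set
  IsSpecialLinear {n} T = Σ[ A ∈ Matrix n ] det A ≈ 1# × (∀ w → to T w ≋ A *ᵥ w)

  -- SL Z / Z, where Z is the group of scalars, as a set of elements of PΓL = ΓL / Z.
  PSL : ∀ n → Pred (Group.Carrier (PΓL n)) 0ℓ
  PSL n T = ∃[ S ] IsSpecialLinear (proj₁ S) × Group._≈_ (PΓL n) S T

  record Subspace (n d : ℕ) : Set₁ where
    field
      On          : Pred (Vector Carrier n) 0ℓ
      resp        : ∀ {u w} → u ≋ w → u ∈ On → w ∈ On
      𝟎-on        : 𝟎 ∈ On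
      ⊕-closed    : ∀ {u w} → u ∈ On → w ∈ On → (u ⊕ w) ∈ On
      •-closed    : ∀ s {w} → w ∈ On → (s • w) ∈ On
      basis       : Vector (Vector Carrier n) d
      basis-on    : ∀ j → basis j ∈ On
      independent : ∀ s → combination s basis ≋ 𝟎 → ∀ j → s j ≈ 0#
      spanning    : ∀ {w} → w ∈ On → ∃[ s ] w ≋ combination s basis

  open Subspace using (On)

  -- Subspaces are equal when they have the same vectors; the basis only
  -- witnesses the dimension d.
  Subspaces : ℕ → ℕ → Setoid (lsuc 0ℓ) 0ℓ
  Subspaces n d = record
    { Carrier       = Subspace n d
    ; _≈_           = λ U W → On U ≐ On W
    ; isEquivalence = record
      { refl  = (λ x → x) , (λ x → x)
      ; sym   = λ (f , g) → g , f
      ; trans = λ (f , g) (f′ , g′) → (λ x → f′ (f x)) , (λ x → g (g′ x))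
      }
    }

  Points Hyperplanes : ℕ → Setoid (lsuc 0ℓ) 0ℓ
  Points n      = Subspaces n 1
  Hyperplanes n = Subspaces n (n ∸ 1)

  -- Since T is bijective, this says T U = W.
  _Maps_To_ : ∀ {n d} → Group.Carrier (PΓL n) → Subspace n d → Subspace n d → Set
  (T , _) Maps U To W = ∀ w → w ∈ On U ⇔ to T w ∈ On W

  -- Γ, acting on X and on Y, is a group with socle PSL(n, F) acting on X as on
  -- the points and on Y as on the hyperplanes of PG(n - 1, F): up to
  -- identifications of Γ with a subgroup of PΓL(n, F), and of X and Y with the
  -- sets of points and hyperplanes.  No group outside PΓL(n, F) is lost: Γ is
  -- faithful on points, as PSL(n, F) is, and normalises PSL(n, F) there.
  record ActsOnPointsAndHyperplanes
    (n : ℕ) (Γ : Group 0ℓ 0ℓ) (X Y : Setoid 0ℓ 0ℓ)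
    (actX : Group.Carrier Γ → Setoid.Carrier X → Setoid.Carrier X)
    (actY : Group.Carrier Γ → Setoid.Carrier Y → Setoid.Carrier Y) : Set₁ where
    field
      ρ           : Group.Carrier Γ → Group.Carrier (PΓL n)
      ρ-mono      : IsGroupMonomorphism (Group.rawGroup Γ) (Group.rawGroup (PΓL n)) ρ
      socle⇒PSL   : ∀ g → g ∈ Socle Γ → ρ g ∈ PSL n
      PSL⇒socle   : ∀ T → T ∈ PSL n → ∃[ g ] g ∈ Socle Γ × Group._≈_ (PΓL n) (ρ g) T
      point       : Inverse X (Points n)
      point-equivariant :
        ∀ g x → ρ g Maps to point x To to point (actX g x)
      hyperplane  : Inverse Y (Hyperplanes n)
      hyperplane-equivariant :
        ∀ g y → ρ g Maps to hyperplane y To to hyperplane (actY g y)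

{-# OPTIONS --safe #-}
-- By flag- and antiflag-transitivity, whether p lies on the hyperplane of the part of B depends
-- only on whether p is on B; hence either every block has the points of its hyperplane, or every
-- block has the points off it.  In a projective space of dimension at least 2 two hyperplanes
-- share a point and two hyperplanes do not cover all points, so any two blocks intersect.  Then G
-- is 2-transitive on blocks and preserves no non-trivial partition of them.
module Submission where

open import Defs
open import Algebra.Apartness.Bundles using (HeytingCommutativeRing; HeytingField)
open import Algebra.Bundles using (CommutativeRing; Group)
import Algebra.Properties.AbelianGroup as AbelianGroupProperties
import Algebra.Properties.Ring as RingProperties
import Algebra.Properties.Semiring.Sum as SemiringSum
open import Data.Empty using (⊥)
open import Data.Fin.Base using (Fin; zero; suc; combine; remQuot; finToFun; funToFin)
open import Data.Fin.Properties using (_≟_; any?; pigeonhole; <⇒≢; ¬∀⟶∃¬; combine-remQuot; finToFun-funToFin)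
open import Data.List.Base using (length; filter; allFin)
open import Data.List.Properties using (filter-none; filter-all; length-tabulate)
open import Data.List.Relation.Unary.All.Properties using (tabulate⁺)
open import Data.Nat.Base using (ℕ; zero; suc; _+_; _∸_; _*_; _^_; _<_; _≤_; z≤n; s≤s; nonTrivial⇒n>1)
import Data.Nat.Properties as ℕ
open import Data.Nat.Primality using (prime⇒nonTrivial)
open import Data.Product.Base using (Σ-syntax; ∃-syntax; _×_; _,_; proj₁; proj₂; uncurry)
open import Data.Vec.Functional using (Vector)
open import Function.Base using (_∘_)
open import Function.Bundles using (Inverse; Injection; Equivalence; _⇔_; mk⇔)
open import Function.Properties.Inverse using (Inverse⇒Injection)
open import Level using (0ℓ)
open import Relation.Binary.Core using (Rel)
open import Relation.Binary.Bundles using (Setoid)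
open import Relation.Binary.PropositionalEquality as ≡ using (_≡_; _≢_; _≗_; refl; setoid)
import Relation.Binary.Reasoning.Setoid as SetoidReasoning
open import Relation.Nullary.Decidable using (Dec; yes; no; decidable-stable; ¬¬-excluded-middle)
open import Relation.Nullary.Negation using (¬_; contradiction)
open import Relation.Unary using (Pred; _∈_; _∉_; _⊆_; _≐_; Decidable)

finToFun-injective : ∀ {m n} {i j : Fin (m ^ n)} →
                     finToFun {m} {n} i ≗ finToFun j → i ≡ j
finToFun-injective {n = zero} {zero} {zero} _ = refl
finToFun-injective {m} {suc n} {i} {j} e = begin
  i                                        ≡⟨ combine-remQuot {m} (m ^ n) i ⟨
  uncurry combine (remQuot {m} (m ^ n) i)  ≡⟨ ≡.cong₂ combine (e zero) (finToFun-injective {m} {n} (e ∘ suc)) ⟩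
  uncurry combine (remQuot {m} (m ^ n) j)  ≡⟨ combine-remQuot {m} (m ^ n) j ⟩
  j                                        ∎
  where open ≡.≡-Reasoning

not-onto : ∀ {m n} → m < n → (f : Fin m → Fin n) → ∃[ y ] ∀ x → f x ≢ y
not-onto {n = n} m<n f =
  let y , y∉ = ¬∀⟶∃¬ n (λ y → ∃[ x ] f x ≡ y) (λ y → any? (λ x → f x ≟ y)) onto-absurd
  in y , λ x e → y∉ (x , e)
  where
  onto-absurd : ¬ (∀ y → ∃[ x ] f x ≡ y)
  onto-absurd g =
    let i , j , i<j , e = pigeonhole m<n (proj₁ ∘ g)
    in <⇒≢ i<j (≡.trans (≡.sym (proj₂ (g i))) (≡.trans (≡.cong f e) (proj₂ (g j))))

module _ {v} {P : Pred (Fin v) 0ℓ} (P? : Decidable P) where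

  filter-nonempty⇒∃ : 0 < length (filter P? (allFin v)) → ∃[ p ] P p
  filter-nonempty⇒∃ 0<l with any? P?
  ... | yes p = p
  ... | no ¬p = contradiction
    (≡.subst (0 <_) (≡.cong length (filter-none P? (tabulate⁺ λ p Pp → ¬p (p , Pp)))) 0<l) λ ()

  filter-proper⇒∃¬ : length (filter P? (allFin v)) < v → ∃[ p ] ¬ P p
  filter-proper⇒∃¬ l<v = ¬∀⟶∃¬ v P P? λ all → ℕ.<-irrefl
    (≡.trans (≡.cong length (filter-all P? (tabulate⁺ all))) (length-tabulate (λ i → i))) l<v

1<primePower : ∀ {q} → IsPrimePower q → 1 < q
1<primePower (r , e , r-prime , refl) = ℕ.^-monoʳ-< r 1<r {0} {suc e} (s≤s z≤n)
  where 1<r = nonTrivial⇒n>1 r ⦃ prime⇒nonTrivial r-prime ⦄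

a<2[a∸1] : ∀ {a} → 3 ≤ a → a < (a ∸ 1) + (a ∸ 1)
a<2[a∸1] (s≤s (s≤s (s≤s {n = n} z≤n))) = s≤s (s≤s (ℕ.m≤n+m (suc (suc n)) n))

a∸1<a : ∀ {a} → 3 ≤ a → a ∸ 1 < a
a∸1<a (s≤s _) = ℕ.≤-refl

module FiniteProjective (F : HeytingField 0ℓ 0ℓ 0ℓ) where
  open HeytingField F using (_#_; tight; #⇒invertible; heytingCommutativeRing)
  open CommutativeRing (HeytingCommutativeRing.commutativeRing heytingCommutativeRing)
    hiding (refl; zero) renaming (_+_ to _+F_; _*_ to _*F_; setoid to F-setoid)
  open AbelianGroupProperties +-abelianGroup using (x∙y⁻¹≈ε⇒x≈y; x≈z//y; xyx⁻¹≈y; //-rightDividesʳ)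
  open RingProperties ring using (-1*x≈-x; -0#≈0#)
  open SemiringSum semiring using (sum; sum-cong-≋; ∑-distrib-+; *-distribˡ-sum)
  open Projective F
  open Subspace
  open SetoidReasoning F-setoid
  private module V {n} = Setoid (V n)

  _⊖_ : ∀ {n} → Vector Carrier n → Vector Carrier n → Vector Carrier n
  u ⊖ w = u ⊕ ((- 1#) • w)

  ⊖-index : ∀ {n} (u w : Vector Carrier n) i → (u ⊖ w) i ≈ u i - w i
  ⊖-index u w i = +-congˡ (-1*x≈-x (w i))

  ⊖≋𝟎⇒≋ : ∀ {n} {u w : Vector Carrier n} → u ⊖ w ≋ 𝟎 → u ≋ w
  ⊖≋𝟎⇒≋ {u = u} {w} e i = x∙y⁻¹≈ε⇒x≈y (u i) (w i) (trans (sym (⊖-index u w i)) (e i))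

  ≋⇒⊖≋𝟎 : ∀ {n} {u w : Vector Carrier n} → u ≋ w → u ⊖ w ≋ 𝟎
  ≋⇒⊖≋𝟎 {u = u} {w} e i = trans (⊖-index u w i) (trans (+-congʳ (e i)) (-‿inverseʳ (w i)))

  ⊖-closed : ∀ {n d} (U : Subspace n d) {u w} → u ∈ On U → w ∈ On U → (u ⊖ w) ∈ On U
  ⊖-closed U u∈ w∈ = ⊕-closed U u∈ (•-closed U (- 1#) w∈)

  combination-cong : ∀ {n d} {s t : Vector Carrier d} (ws : Vector (Vector Carrier n) d) →
                     s ≋ t → combination s ws ≋ combination t ws
  combination-cong ws e i = sum-cong-≋ (λ j → *-congʳ (e j))

  combination-⊖ : ∀ {n d} (s t : Vector Carrier d) (ws : Vector (Vector Carrier n) d) →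
                  combination (s ⊖ t) ws ≋ combination s ws ⊖ combination t ws
  combination-⊖ s t ws i = begin
    sum (λ j → (s ⊖ t) j *F ws j i)
      ≈⟨ sum-cong-≋ (λ j → trans (distribʳ (ws j i) (s j) _) (+-congˡ (*-assoc (- 1#) (t j) (ws j i)))) ⟩
    sum (λ j → s j *F ws j i +F - 1# *F (t j *F ws j i))
      ≈⟨ ∑-distrib-+ (λ j → s j *F ws j i) _ ⟩
    combination s ws i +F sum (λ j → - 1# *F (t j *F ws j i))
      ≈⟨ +-congˡ (*-distribˡ-sum (- 1#) (λ j → t j *F ws j i)) ⟨
    (combination s ws ⊖ combination t ws) i ∎

  combination∈ : ∀ {n d} (U : Subspace n d) s → combination s (basis U) ∈ On U
  combination∈ U s = go s (basis U) (basis-on U)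
    where
    go : ∀ {e} (s : Vector Carrier e) ws → (∀ j → ws j ∈ On U) → combination s ws ∈ On U
    go {zero}  s ws ws∈ = 𝟎-on U
    go {suc e} s ws ws∈ = ⊕-closed U (•-closed U (s zero) (ws∈ zero)) (go (s ∘ suc) (ws ∘ suc) (ws∈ ∘ suc))

  combination-injective : ∀ {n d} (U : Subspace n d) {s t} →
                          combination s (basis U) ≋ combination t (basis U) → s ≋ t
  combination-injective U {s} {t} e = ⊖≋𝟎⇒≋
    (independent U (s ⊖ t) (V.trans (combination-⊖ s t (basis U)) (≋⇒⊖≋𝟎 e)))

  #⇒inverse : ∀ {s} → s # 0# → ∃[ t ] t *F s ≈ 1#
  #⇒inverse {s} s# = let t , e , _ = #⇒invertible s# in
    t , trans (*-congˡ (trans (sym (+-identityʳ s)) (+-congˡ (sym -0#≈0#)))) e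

  span : ∀ {n} (w : Vector Carrier n) → ¬ (w ≋ 𝟎) → Subspace n 1
  span w w≉𝟎 = record
    { On          = λ u → ∃[ s ] u ≋ s • w
    ; resp        = λ e (s , e′) → s , V.trans (V.sym e) e′
    ; 𝟎-on        = 0# , λ i → sym (zeroˡ (w i))
    ; ⊕-closed    = λ (s , e) (t , e′) → s +F t , λ i →
        trans (+-cong (e i) (e′ i)) (sym (distribʳ (w i) s t))
    ; •-closed    = λ r (s , e) → r *F s , λ i → trans (*-congˡ (e i)) (sym (*-assoc r s (w i)))
    ; basis       = λ _ → w
    ; basis-on    = λ _ → 1# , λ i → sym (*-identityˡ (w i))
    ; independent = λ { s e zero → proj₁ (tight _ _) λ s# → w≉𝟎 λ i →
        let t , ts≈1 = #⇒inverse s# in begin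
          w i                 ≈⟨ *-identityˡ (w i) ⟨
          1# *F w i           ≈⟨ *-congʳ ts≈1 ⟨
          (t *F s zero) *F w i ≈⟨ *-assoc t (s zero) (w i) ⟩
          t *F (s zero *F w i) ≈⟨ *-congˡ (trans (sym (+-identityʳ _)) (e i)) ⟩
          t *F 0#             ≈⟨ zeroʳ t ⟩
          0#                  ∎ }
    ; spanning    = λ (s , e) → (λ _ → s) , λ i → trans (e i) (sym (+-identityʳ _))
    }

  ∈-span : ∀ {n} {w : Vector Carrier n} w≉𝟎 → w ∈ On (span w w≉𝟎)
  ∈-span {w = w} _ = 1# , λ i → sym (*-identityˡ (w i))

  span-⊆ : ∀ {n d} (U : Subspace n d) {w} w≉𝟎 → w ∈ On U → On (span w w≉𝟎) ⊆ On U
  span-⊆ U _ w∈ (s , e) = resp U (V.sym e) (•-closed U s w∈)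

  outside⇒≉𝟎 : ∀ {n d} (U : Subspace n d) {w} → w ∉ On U → ¬ (w ≋ 𝟎)
  outside⇒≉𝟎 U w∉ w≋𝟎 = w∉ (resp U (V.sym w≋𝟎) (𝟎-on U))

  module _ {q} (1<q : 1 < q) (order : HasOrder q) where
    open Inverse order using (to; from; inverseˡ)

    vec : ∀ {n} → Fin (q ^ n) → Vector Carrier n
    vec i j = to (finToFun i j)

    code : ∀ {n} → Vector Carrier n → Fin (q ^ n)
    code w = funToFin (from ∘ w)

    vec-code : ∀ {n} (w : Vector Carrier n) → vec (code w) ≋ w
    vec-code w j = inverseˡ (finToFun-funToFin (from ∘ w) j)

    vec-injective : ∀ {n} {i j : Fin (q ^ n)} → vec {n} i ≋ vec j → i ≡ j
    vec-injective {n} e =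
      finToFun-injective {q} {n} λ k → Injection.injective (Inverse⇒Injection order) (e k)

    code-injective : ∀ {n} {u w : Vector Carrier n} → code u ≡ code w → u ≋ w
    code-injective {u = u} {w} e =
      V.trans (V.sym (vec-code u)) (V.trans (λ j → reflexive (≡.cong (λ i → vec i j) e)) (vec-code w))

    element : ∀ {n d} (U : Subspace n d) → Fin (q ^ d) → Vector Carrier n
    element U i = combination (vec i) (basis U)

    element-injective : ∀ {n d} (U : Subspace n d) {i j} → element U i ≋ element U j → i ≡ j
    element-injective U e = vec-injective (combination-injective U e)

    -- The difference of a collision of (u , w) ↦ u + w on U × W lies in U ∩ W.
    common-vector : ∀ {n d e} → n < d + e → (U : Subspace n d) (W : Subspace n e) →
                    ∃[ w ] w ∈ On U × w ∈ On W × ¬ (w ≋ 𝟎)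
    common-vector {n} {d} {e} n<d+e U W =
      let x , y , x<y , x~y = pigeonhole q^n<q^d*q^e (code ∘ uncurry _⊞_ ∘ pair)
          i , i′ = pair x
          j , j′ = pair y
          shared = transpose (code-injective x~y)
      in element U i ⊖ element U j
       , ⊖-closed U (combination∈ U _) (combination∈ U _)
       , resp W (V.sym shared) (⊖-closed W (combination∈ W _) (combination∈ W _))
       , λ zero → <⇒≢ x<y (pair-injective
           (element-injective U (⊖≋𝟎⇒≋ zero))
           (≡.sym (element-injective W (⊖≋𝟎⇒≋ (V.trans (V.sym shared) zero)))))
      where
      pair : Fin (q ^ d * q ^ e) → Fin (q ^ d) × Fin (q ^ e)
      pair = remQuot (q ^ e)

      pair-injective : ∀ {x y} → proj₁ (pair x) ≡ proj₁ (pair y) → proj₂ (pair x) ≡ proj₂ (pair y) → x ≡ y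
      pair-injective {x} {y} e₁ e₂ = ≡.trans (≡.sym (combine-remQuot {q ^ d} (q ^ e) x))
        (≡.trans (≡.cong₂ combine e₁ e₂) (combine-remQuot {q ^ d} (q ^ e) y))

      _⊞_ : Fin (q ^ d) → Fin (q ^ e) → Vector Carrier n
      i ⊞ i′ = element U i ⊕ element W i′

      q^n<q^d*q^e : q ^ n < q ^ d * q ^ e
      q^n<q^d*q^e = ≡.subst (q ^ n <_) (ℕ.^-distribˡ-+-* q d e) (ℕ.^-monoʳ-< q 1<q n<d+e)

      transpose : ∀ {u u′ w w′ : Vector Carrier n} → u ⊕ w ≋ u′ ⊕ w′ → u ⊖ u′ ≋ w′ ⊖ w
      transpose {u} {u′} {w} {w′} h i = trans (⊖-index u u′ i) (trans (begin
        u i - u′ i                      ≈⟨ +-congʳ (x≈z//y (u i) (w i) _ (h i)) ⟩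
        ((u′ i +F w′ i) - w i) - u′ i   ≈⟨ +-congʳ (+-assoc (u′ i) (w′ i) (- w i)) ⟩
        (u′ i +F (w′ i - w i)) - u′ i   ≈⟨ xyx⁻¹≈y (u′ i) (w′ i - w i) ⟩
        w′ i - w i                      ∎) (sym (⊖-index w′ w i)))

    vector-outside : ∀ {n d} → d < n → (U : Subspace n d) → ∃[ w ] w ∉ On U
    vector-outside {n} d<n U =
      let y , y∉ = not-onto (ℕ.^-monoʳ-< q 1<q d<n) (code ∘ element U)
      in vec y , λ w∈ → let s , w≋ = spanning U w∈ in y∉ (code s) (vec-injective {n}
           (V.trans (vec-code (element U (code s)))
             (V.trans (combination-cong (basis U) (vec-code s)) (V.sym w≋))))

    vector-outside-both : ∀ {n d e} → d < n → e < n → (U : Subspace n d) (W : Subspace n e) →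
                          ¬ ¬ (∃[ w ] w ∉ On U × w ∉ On W)
    vector-outside-both d<n e<n U W none =
      let u , u∉U = vector-outside d<n U
          w , w∉W = vector-outside e<n W
      in none (u , u∉U , λ u∈W → none (w , (λ w∈U → none (u ⊕ w
           , (λ u+w∈U → u∉U (resp U (cancelʳ u w) (⊖-closed U u+w∈U w∈U)))
           , (λ u+w∈W → w∉W (resp W (cancelˡ u w) (⊖-closed W u+w∈W u∈W))))) , w∉W))
      where
      cancelʳ : ∀ {n} (u w : Vector Carrier n) → (u ⊕ w) ⊖ w ≋ u
      cancelʳ u w i = trans (⊖-index (u ⊕ w) w i) (//-rightDividesʳ (w i) (u i))
      cancelˡ : ∀ {n} (u w : Vector Carrier n) → (u ⊕ w) ⊖ u ≋ w
      cancelˡ u w i = trans (⊖-index (u ⊕ w) u i) (xyx⁻¹≈y (u i) (w i))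

  On-⊆-transfer : ∀ {n d e} (g : Group.Carrier (PΓL n)) {U U′ : Subspace n d} {W W′ : Subspace n e} →
                  g Maps U To U′ → g Maps W To W′ → On U ⊆ On W ⇔ On U′ ⊆ On W′
  On-⊆-transfer (T , _) {U} {U′} {W} {W′} U→U′ W→W′ = mk⇔
    (λ U⊆W {u} u∈ → resp W′ (T-from u) (to (W→W′ _) (U⊆W (from (U→U′ _) (resp U′ (V.sym (T-from u)) u∈)))))
    (λ U′⊆W′ {w} w∈ → from (W→W′ w) (U′⊆W′ (to (U→U′ w) w∈)))
    where
    open Equivalence
    T-from : ∀ u → Inverse.to T (Inverse.from T u) ≋ u
    T-from u = Inverse.inverseˡ T V.refl

module _ {v b k lam} (𝒟 : Design v b) (2-design : Is2Design 𝒟 k lam) where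
  open Design 𝒟
  open Is2Design 2-design

  point-on : 0 < k → ∀ B → ∃[ p ] p I B
  point-on 0<k B = filter-nonempty⇒∃ (_I? B) (≡.subst (0 <_) (≡.sym (block-size B)) 0<k)

  point-off : k < v → ∀ B → ∃[ p ] ¬ (p I B)
  point-off k<v B = filter-proper⇒∃¬ (_I? B) (≡.subst (_< v) (≡.sym (block-size B)) k<v)

lemma4p13 : {v b k lam : ℕ} (𝒟 : Design v b) →
    Is2Design 𝒟 k lam → 2 < k → k < v →
    (G : Subgroup (asGroup (Aut 𝒟)) 0ℓ) →
    IsPairwiseTransitive 𝒟 G →
    IsAlmostSimple (asGroup (inducedOnPoints 𝒟 G)) →
    HasRank (inducedOnBlocks 𝒟 G) 3 →
    (_∼_ : Rel (Fin b) 0ℓ)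
    (𝒮 : IsNontrivialImprimitivitySystem (inducedOnBlocks 𝒟 G) _∼_) →
    ¬ (∃[ a ] ∃[ q ] 3 ≤ a × IsPrimePower q ×
    (Σ[ F ∈ HeytingField 0ℓ 0ℓ 0ℓ ]
    Projective.HasOrder F q ×
    Projective.ActsOnPointsAndHyperplanes F a (asGroup G)
    (setoid (Fin v)) (IsNontrivialImprimitivitySystem.parts 𝒮)
    (onPoint 𝒟 G) (onBlock 𝒟 G)))
lemma4p13 {v} {b} {k} 𝒟 2-design 2<k k<v G transitive _ (_ , B₀ , _) _∼_ 𝒮
  (a , q , 3≤a , q-pp , F , order , action) =
  ¬¬-excluded-middle λ on? → ¬¬-excluded-middle λ off? → absurd on? off?
  where
  open Design 𝒟
  open Projective F
  open FiniteProjective F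
  open Subspace
  open ActsOnPointsAndHyperplanes action
  open IsPairwiseTransitive transitive
  open IsNontrivialImprimitivitySystem 𝒮
  open Equivalence using (to; from)

  1<q : 1 < q
  1<q = 1<primePower q-pp

  pointOf : Fin v → Subspace a 1
  pointOf = Inverse.to point

  hyperplaneOf : Fin b → Subspace a (a ∸ 1)
  hyperplaneOf = Inverse.to hyperplane

  _≺_ : Fin v → Fin b → Set
  p ≺ B = On (pointOf p) ⊆ On (hyperplaneOf B)

  ≺-invariant : ∀ g {p B p′ B′} → onPoint 𝒟 G g p ≡ p′ → onBlock 𝒟 G g B ≡ B′ → p ≺ B ⇔ p′ ≺ B′
  ≺-invariant g {p} {B} refl refl = On-⊆-transfer (ρ g)
    {pointOf p} {pointOf (onPoint 𝒟 G g p)} {hyperplaneOf B} {hyperplaneOf (onBlock 𝒟 G g B)}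
    (point-equivariant g p) (hyperplane-equivariant g B)

  pointThrough : ∀ w → ¬ (w ≋ 𝟎) → Fin v
  pointThrough w w≉𝟎 = Inverse.from point (span w w≉𝟎)

  ≺⇔∈ : ∀ {w} w≉𝟎 B → pointThrough w w≉𝟎 ≺ B ⇔ w ∈ On (hyperplaneOf B)
  ≺⇔∈ {w} w≉𝟎 B = mk⇔
    (λ p≺B → p≺B (proj₂ same (∈-span w≉𝟎)))
    (λ w∈B {u} u∈p → span-⊆ (hyperplaneOf B) w≉𝟎 w∈B (proj₁ same u∈p))
    where
    same : On (pointOf (pointThrough w w≉𝟎)) ≐ On (span w w≉𝟎)
    same = Inverse.inverseˡ point refl

  common-point : ∀ B C → ∃[ p ] p ≺ B × p ≺ C
  common-point B C =
    let w , w∈B , w∈C , w≉𝟎 = common-vector 1<q order (a<2[a∸1] 3≤a) (hyperplaneOf B) (hyperplaneOf C)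
    in pointThrough w w≉𝟎 , from (≺⇔∈ w≉𝟎 B) w∈B , from (≺⇔∈ w≉𝟎 C) w∈C

  point-outside-both : ∀ B C → ¬ ¬ (∃[ p ] ¬ (p ≺ B) × ¬ (p ≺ C))
  point-outside-both B C none =
    vector-outside-both 1<q order (a∸1<a 3≤a) (a∸1<a 3≤a) (hyperplaneOf B) (hyperplaneOf C) λ (w , w∉B , w∉C) →
      let w≉𝟎 = outside⇒≉𝟎 (hyperplaneOf B) w∉B
      in none (pointThrough w w≉𝟎 , w∉B ∘ to (≺⇔∈ w≉𝟎 B) , w∉C ∘ to (≺⇔∈ w≉𝟎 C))

  some-disjoint : ¬ (∀ B C → ¬ ¬ Intersecting 𝒟 B C)
  some-disjoint meet =
    let C , B₀≢C , B₀∼C = not-singleton B₀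
        D , B₀≁D        = not-whole B₀
        B₀≢D : B₀ ≢ D
        B₀≢D B₀≡D = B₀≁D (respects B₀≡D)
    in meet B₀ C λ i → meet B₀ D λ j →
      let g , e , e′ = intersecting B₀≢C i B₀≢D j
      in B₀≁D (≡.subst₂ _∼_ e e′ (invariant {h = blockPerm 𝒟 G g} (g , λ _ → refl) B₀∼C))

  p₀ : ∃[ p ] p I B₀
  p₀ = point-on 𝒟 2-design (ℕ.<-trans (s≤s z≤n) 2<k) B₀

  p₁ : ∃[ p ] ¬ (p I B₀)
  p₁ = point-off 𝒟 2-design k<v B₀

  on⇒ : ∀ {p C} → p I C → proj₁ p₀ ≺ B₀ ⇔ p ≺ C
  on⇒ pIC = let g , e , e′ = flags (proj₂ p₀) pIC in ≺-invariant g e e′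

  off⇒ : ∀ {p C} → ¬ (p I C) → proj₁ p₁ ≺ B₀ ⇔ p ≺ C
  off⇒ p∤C = let g , e , e′ = antiflags (proj₂ p₁) p∤C in ≺-invariant g e e′

  absurd : Dec (proj₁ p₀ ≺ B₀) → Dec (proj₁ p₁ ≺ B₀) → ⊥
  absurd (yes p₀≺) (yes p₁≺) = point-outside-both B₀ B₀ λ (p , p⊀ , _) →
    p⊀ (to (off⇒ λ pI → p⊀ (to (on⇒ pI) p₀≺)) p₁≺)
  absurd (no p₀⊀) (no p₁⊀) =
    let p , p≺ , _ = common-point B₀ B₀
    in p₁⊀ (from (off⇒ λ pI → p₀⊀ (from (on⇒ pI) p≺)) p≺)
  absurd (yes _) (no p₁⊀) = some-disjoint λ B C disjoint →
    let p , p≺B , p≺C = common-point B C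
    in disjoint (p , ≺⇒I p≺B , ≺⇒I p≺C)
    where
    ≺⇒I : ∀ {p B} → p ≺ B → p I B
    ≺⇒I {p} {B} p≺B = decidable-stable (p I? B) λ p∤B → p₁⊀ (from (off⇒ p∤B) p≺B)
  absurd (no _) (yes p₁≺) = some-disjoint λ B C disjoint →
    point-outside-both B C λ (p , p⊀B , p⊀C) → disjoint (p , ⊀⇒I p⊀B , ⊀⇒I p⊀C)
    where
    ⊀⇒I : ∀ {p B} → ¬ (p ≺ B) → p I B
    ⊀⇒I {p} {B} p⊀B = decidable-stable (p I? B) λ p∤B → p⊀B (to (off⇒ p∤B) p₁≺)
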